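{- Let $k\ge 1$ and $n\ge 1$ be integers. The number of $k$-Schröder paths of type B of size $n$ is given by $$|\mathtt{Sch}^{B}(n;k)|=\frac{1}{n}\sum_{m=0}^{n-1}2^{m+1}\binom{nk}{m}\binom{n}{n-m-1},$$ and also by $$|\mathtt{Sch}^{B}(n;k)|=\frac{1}{n}\sum_{j=0}^{n}\binom{n}{j}\binom{kn+j}{n-1}.$$
   Context: A $k$-Schröder path of type B of size $n$ is a lattice path from $(0,0)$ to $(kn,n)$ consisting of up steps $U=(0,1)$, down steps $D=(1,0)$ and horizontal steps $H=(1,1)$, which never goes below the line $y=x/k$. The set of such paths is denoted $\mathtt{Sch}^{B}(n;k)$. -}

module Defs where

open import Data.Nat using (ℕ; suc; _*_; _≤_)
open import Data.List using (List; foldl; map; sum; upTo)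
open import Data.List.Relation.Unary.All using (All)
open import Data.List.Scans.Base using (scanl)
open import Data.Integer using (+_)
open import Data.Product using (Σ; _×_; _,_)
open import Data.Rational using (ℚ; _/_)
open import Relation.Binary.PropositionalEquality using (_≡_)

data Step : Set where
  U D H : Step

-- No step decreases a coordinate, so a path that starts at (0,0) only visits
-- points with natural-number coordinates.
Point : Set
Point = ℕ × ℕ

move : Point → Step → Point
move (x , y) U = x , suc y
move (x , y) D = suc x , y
move (x , y) H = suc x , suc y

-- A path is given by its list of steps, starting from (0,0).
endpoint : List Step → Point
endpoint = foldl move (0 , 0)

-- All lattice points visited, including (0,0) and the endpoint.
vertices : List Step → List Point
vertices = scanl move (0 , 0)

-- y ≥ x / k with the denominator k ≥ 1 cleared.
OnOrAboveLine : ℕ → Point → Set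
OnOrAboveLine k (x , y) = x ≤ k * y

-- The steps are straight segments and the region y ≥ x / k is convex, so a
-- path stays in it exactly when all its vertices do.
NeverBelowLine : ℕ → List Step → Set
NeverBelowLine k p = All (OnOrAboveLine k) (vertices p)

-- The type of k-Schröder paths of type B of size n.  Both conditions on the
-- list of steps are proof-irrelevant propositions, so elements of this type
-- correspond one-to-one to paths.
SchB : (n k : ℕ) → Set
SchB n k = Σ (List Step) λ p → endpoint p ≡ (k * n , n) × NeverBelowLine k p

-- ∑< n f = f 0 + … + f (n - 1)
∑< : ℕ → (ℕ → ℕ) → ℕ
∑< n f = sum (map f (upTo n))

fromℕ : ℕ → ℚ
fromℕ m = + m / 1

{-# OPTIONS --safe #-}

-- Let k ≥ 1, let h = k y - x be the height of a path above the line and n the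
-- number of rows left.  The number of ways G h n to finish satisfies, by the
-- choice of the next step,
--   G h n = G (h - 1) n + G (h + k) (n - 1) + G (h + k - 1) (n - 1).
-- With T a n m = [zᵐ] (1 + z)ᵃ (2 + z)ⁿ and a = h + k n, it is solved by
--   G h n = T a n n + T a (n - 1) (n - 1) - k T a n (n - 1),
-- since the relations T (a + 1) n m = T a n m + T a n (m - 1) and
-- T a (n + 1) m = T a n m + T (a + 1) n m turn it into the recurrence.  The
-- expression vanishes at h = -1 and equals T a n (n - 1) / n at h = 0 because of
--   n (T a n n + T a (n - 1) (n - 1)) = (a + 1) T a n (n - 1).
-- The two sums are the two expansions of T (k n) n (n - 1): expand
-- (2 + z)ⁿ = (1 + (1 + z))ⁿ, or multiply out the coefficients of (1 + z)ᵃ and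
-- (2 + z)ⁿ.
module Submission where

open import Defs
open import Data.Nat using (ℕ; zero; suc; pred; _+_; _*_; _∸_; _^_; _≤_; _<_; z≤n; s≤s; NonZero)
open import Data.Nat.Properties
open import Data.Nat.Combinatorics using (_C_; nCk+nC[k+1]≡[n+1]C[k+1]; k>n⇒nCk≡0)
open import Data.Nat.Tactic.RingSolver using (solve-∀)
open import Data.Fin using (Fin)
open import Data.Fin.Properties using (+↔⊎; 0↔⊥; 1↔⊤)
import Data.Integer as ℤ
import Data.Integer.Properties as ℤ
open import Data.List using (List; []; _∷_; foldl)
open import Data.List.Properties using (map-applyUpTo; map-upTo)
open import Data.Nat.ListAction using (sum)
open import Data.List.Relation.Unary.All using (All; []; _∷_; head)
open import Data.List.Scans.Base using (scanl)
open import Data.Empty using (⊥-elim)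
open import Data.Unit using (tt)
open import Data.Product using (Σ; ∃; _×_; _,_; proj₁; proj₂)
open import Data.Product.Properties using (≡-dec)
open import Data.Sum using (_⊎_; inj₁; inj₂)
open import Data.Sum.Function.Propositional using (_⊎-↔_)
open import Data.Rational using (_/_; toℚᵘ) renaming (_*_ to _*ℚ_)
open import Data.Rational.Properties using (toℚᵘ-injective; toℚᵘ-fromℚᵘ; toℚᵘ-homo-*)
open import Data.Rational.Unnormalised using (mkℚᵘ; *≡*)
import Data.Rational.Unnormalised as ℚᵘ
import Data.Rational.Unnormalised.Properties as ℚᵘ
open import Algebra.Properties.CommutativeSemigroup +-commutativeSemigroup using (interchange; x∙yz≈y∙xz)
open import Axiom.UniquenessOfIdentityProofs using (module Decidable⇒UIP)
open import Function.Bundles using (_↔_; mk↔ₛ′)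
open import Function.Properties.Inverse using (↔-sym; ↔-trans)
open import Relation.Binary.PropositionalEquality
open import Relation.Nullary using (¬_)

-- Finite sums.

∑<-suc : ∀ n f → ∑< (suc n) f ≡ f 0 + ∑< n (λ i → f (suc i))
∑<-suc n f = cong (λ l → f 0 + sum l)
  (trans (map-applyUpTo suc f n) (sym (map-upTo (λ i → f (suc i)) n)))

∑<-cong : ∀ n {f g} → (∀ i → i < n → f i ≡ g i) → ∑< n f ≡ ∑< n g
∑<-cong zero    eq = refl
∑<-cong (suc n) {f} {g} eq = begin
  ∑< (suc n) f                       ≡⟨ ∑<-suc n f ⟩
  f 0 + ∑< n (λ i → f (suc i))       ≡⟨ cong₂ _+_ (eq 0 (s≤s z≤n)) (∑<-cong n λ i i<n → eq (suc i) (s≤s i<n)) ⟩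
  g 0 + ∑< n (λ i → g (suc i))       ≡⟨ ∑<-suc n g ⟨
  ∑< (suc n) g                       ∎
  where open ≡-Reasoning

∑<-+ : ∀ n f g → ∑< n (λ i → f i + g i) ≡ ∑< n f + ∑< n g
∑<-+ zero    f g = refl
∑<-+ (suc n) f g = begin
  ∑< (suc n) (λ i → f i + g i)
    ≡⟨ ∑<-suc n _ ⟩
  (f 0 + g 0) + ∑< n (λ i → f (suc i) + g (suc i))
    ≡⟨ cong (_ +_) (∑<-+ n _ _) ⟩
  (f 0 + g 0) + (∑< n (λ i → f (suc i)) + ∑< n (λ i → g (suc i)))
    ≡⟨ interchange (f 0) (g 0) _ _ ⟩
  (f 0 + ∑< n (λ i → f (suc i))) + (g 0 + ∑< n (λ i → g (suc i)))
    ≡⟨ cong₂ _+_ (∑<-suc n f) (∑<-suc n g) ⟨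
  ∑< (suc n) f + ∑< (suc n) g ∎
  where
  open ≡-Reasoning

∑<-last : ∀ n f → ∑< (suc n) f ≡ ∑< n f + f n
∑<-last zero    f = +-identityʳ (f 0)
∑<-last (suc n) f = begin
  ∑< (suc (suc n)) f                         ≡⟨ ∑<-suc (suc n) f ⟩
  f 0 + ∑< (suc n) (λ i → f (suc i))         ≡⟨ cong (f 0 +_) (∑<-last n _) ⟩
  f 0 + (∑< n (λ i → f (suc i)) + f (suc n)) ≡⟨ +-assoc (f 0) _ _ ⟨
  f 0 + ∑< n (λ i → f (suc i)) + f (suc n)   ≡⟨ cong (_+ f (suc n)) (∑<-suc n f) ⟨
  ∑< (suc n) f + f (suc n)                   ∎
  where open ≡-Reasoning

-- Binomial coefficients.

pascal : ∀ n k → suc n C suc k ≡ n C k + n C suc k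
pascal n k = sym (nCk+nC[k+1]≡[n+1]C[k+1] n k)

-- The common inductive step of `T-binomial` and `T-vandermonde`; `l` is free because the two
-- truncate their sums differently.
∑<-pascal : ∀ n l (f : ℕ → ℕ) → ∑< (suc l) (λ i → (suc n C i) * f i)
  ≡ ∑< l (λ i → (n C i) * f (suc i)) + ∑< (suc l) (λ i → (n C i) * f i)
∑<-pascal n l f = begin
  ∑< (suc l) (λ i → (suc n C i) * f i)
    ≡⟨ ∑<-suc l (λ i → (suc n C i) * f i) ⟩
  1 * f 0 + ∑< l (λ i → (suc n C suc i) * f (suc i))
    ≡⟨ cong (1 * f 0 +_) (∑<-cong l λ i _ →
         trans (cong (_* f (suc i)) (pascal n i)) (*-distribʳ-+ (f (suc i)) (n C i) (n C suc i))) ⟩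
  1 * f 0 + ∑< l (λ i → u i + v i)
    ≡⟨ cong (1 * f 0 +_) (∑<-+ l u v) ⟩
  1 * f 0 + (∑< l u + ∑< l v)
    -- The term at index 0 is `1 * f 0` in both rows of Pascal's triangle, so it can pass to the
    -- unshifted sum.
    ≡⟨ x∙yz≈y∙xz (1 * f 0) (∑< l u) (∑< l v) ⟩
  ∑< l u + (1 * f 0 + ∑< l v)
    ≡⟨ cong (∑< l u +_) (∑<-suc l (λ i → (n C i) * f i)) ⟨
  ∑< l u + ∑< (suc l) (λ i → (n C i) * f i) ∎
  where
  open ≡-Reasoning
  u v : ℕ → ℕ
  u i = (n C i) * f (suc i)
  v i = (n C suc i) * f (suc i)

-- Comparison of the coefficients of zᵐ in (1 + z) F' = a F for F = (1 + z)ᵃ. Keeping `m * (a C m)`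
-- on the left avoids the factor a - m.
absorption : ∀ a m → suc m * (a C suc m) + m * (a C m) ≡ a * (a C m)
absorption zero    zero    = refl
absorption zero    (suc m) = cong₂ _+_ (*-zeroʳ (suc (suc m))) (*-zeroʳ (suc m))
absorption (suc a) zero    = begin
  1 * (suc a C 1) + 0              ≡⟨ cong (λ c → 1 * c + 0) (pascal a 0) ⟩
  1 * (1 + a C 1) + 0              ≡⟨ arith (a C 1) ⟩
  1 + (1 * (a C 1) + 0)            ≡⟨ cong suc (absorption a 0) ⟩
  1 + a * 1                        ∎
  where
  open ≡-Reasoning
  arith : ∀ c → 1 * (1 + c) + 0 ≡ 1 + (1 * c + 0)
  arith = solve-∀
absorption (suc a) (suc m) = begin
  suc (suc m) * (suc a C suc (suc m)) + suc m * (suc a C suc m)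
    ≡⟨ cong₂ (λ u v → suc (suc m) * u + suc m * v) (pascal a (suc m)) (pascal a m) ⟩
  suc (suc m) * (y + z) + suc m * (x + y)
    ≡⟨ before m x y z ⟩
  (suc (suc m) * z + suc m * y) + (suc m * y + m * x) + (x + y)
    ≡⟨ cong₂ (λ u v → u + v + (x + y)) (absorption a (suc m)) (absorption a m) ⟩
  a * y + a * x + (x + y)
    ≡⟨ after a x y ⟩
  suc a * (x + y)
    ≡⟨ cong (suc a *_) (pascal a m) ⟨
  suc a * (suc a C suc m) ∎
  where
  open ≡-Reasoning
  x = a C m
  y = a C suc m
  z = a C suc (suc m)
  before : ∀ m x y z → suc (suc m) * (y + z) + suc m * (x + y)
    ≡ (suc (suc m) * z + suc m * y) + (suc m * y + m * x) + (x + y)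
  before = solve-∀
  after : ∀ a x y → a * y + a * x + (x + y) ≡ suc a * (x + y)
  after = solve-∀

-- Coefficients of (1 + z)ᵃ (2 + z)ⁿ.

-- [zᵐ] (1 + z)ᵃ (2 + z)ⁿ, where 2 + z = 1 + (1 + z)
T : ℕ → ℕ → ℕ → ℕ
T a zero    m = a C m
T a (suc n) m = T a n m + T (suc a) n m

T-zero : ∀ a n → T a n 0 ≡ 2 ^ n
T-zero a zero    = refl
T-zero a (suc n) = cong₂ _+_ (T-zero a n) (trans (T-zero (suc a) n) (sym (+-identityʳ _)))

-- Multiplication by 1 + z. The recursion of `T` is linear, so Pascal's rule lifts from n = 0 to
-- every `n`.
T-pascal : ∀ a n m → T (suc a) n (suc m) ≡ T a n m + T a n (suc m)
T-pascal a zero    m = pascal a m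
T-pascal a (suc n) m = begin
  T (suc a) n (suc m) + T (suc (suc a)) n (suc m)
    ≡⟨ cong₂ _+_ (T-pascal a n m) (T-pascal (suc a) n m) ⟩
  (T a n m + T a n (suc m)) + (T (suc a) n m + T (suc a) n (suc m))
    ≡⟨ interchange (T a n m) (T a n (suc m)) (T (suc a) n m) (T (suc a) n (suc m)) ⟩
  T a (suc n) m + T a (suc n) (suc m) ∎
  where
  open ≡-Reasoning

-- For F = (1 + z)ᵃ (2 + z)ⁿ⁺¹ one has (1 + z) F' = a F + (n + 1) (1 + z)ᵃ⁺¹ (2 + z)ⁿ. Writing one
-- factor 1 + z of the last term as (2 + z) - 1 and comparing coefficients of zᵐ gives the identity.
T-absorption : ∀ a n m →
  suc m * T a (suc n) (suc m) + m * T a (suc n) m + suc n * T a n m ≡ (a + suc n) * T a (suc n) m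
T-absorption a zero m = begin
  suc m * (x′ + y′) + m * (x + y) + 1 * x
    ≡⟨ before m x y x′ y′ ⟩
  (suc m * x′ + m * x) + (suc m * y′ + m * y) + x
    ≡⟨ cong₂ (λ u v → u + v + x) (absorption a m) (absorption (suc a) m) ⟩
  a * x + suc a * y + x
    ≡⟨ after a x y ⟩
  (a + 1) * (x + y) ∎
  where
  open ≡-Reasoning
  x = a C m
  y = suc a C m
  x′ = a C suc m
  y′ = suc a C suc m
  before : ∀ m x y x′ y′ → suc m * (x′ + y′) + m * (x + y) + 1 * x
    ≡ (suc m * x′ + m * x) + (suc m * y′ + m * y) + x
  before = solve-∀
  after : ∀ a x y → a * x + suc a * y + x ≡ (a + 1) * (x + y)
  after = solve-∀
T-absorption a (suc n) m = begin
  suc m * (x′ + y′) + m * (x + y) + suc (suc n) * (u + v)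
    ≡⟨ before m n u v x y x′ y′ ⟩
  (suc m * x′ + m * x + suc n * u) + (suc m * y′ + m * y + suc n * v) + x
    -- The leftover `u + v` is `x` by definition of `T`; it raises the factor of `x` to that of `y`.
    ≡⟨ cong₂ (λ p q → p + q + x) (T-absorption a n m) (T-absorption (suc a) n m) ⟩
  (a + suc n) * x + (suc a + suc n) * y + x
    ≡⟨ after a n x y ⟩
  (a + suc (suc n)) * (x + y) ∎
  where
  open ≡-Reasoning
  u = T a n m
  v = T (suc a) n m
  x = T a (suc n) m
  y = T (suc a) (suc n) m
  x′ = T a (suc n) (suc m)
  y′ = T (suc a) (suc n) (suc m)
  before : ∀ m n u v x y x′ y′ → suc m * (x′ + y′) + m * (x + y) + suc (suc n) * (u + v)
    ≡ (suc m * x′ + m * x + suc n * u) + (suc m * y′ + m * y + suc n * v) + (u + v)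
  before = solve-∀
  after : ∀ a n x y → (a + suc n) * x + (suc a + suc n) * y + x ≡ (a + suc (suc n)) * (x + y)
  after = solve-∀

-- The case `m = n` of `T-absorption`: there `n * T a (suc n) n` can be cancelled from both sides.
T-diagonal : ∀ a n → suc n * (T a (suc n) (suc n) + T a n n) ≡ suc a * T a (suc n) n
T-diagonal a n = +-cancelʳ-≡ (n * T a (suc n) n) _ _ (begin
  suc n * (y + w) + n * x              ≡⟨ before n x y w ⟩
  suc n * y + n * x + suc n * w        ≡⟨ T-absorption a n n ⟩
  (a + suc n) * x                      ≡⟨ after a n x ⟩
  suc a * x + n * x                    ∎)
  where
  open ≡-Reasoning
  x = T a (suc n) n
  y = T a (suc n) (suc n)
  w = T a n n
  before : ∀ n x y w → suc n * (y + w) + n * x ≡ suc n * y + n * x + suc n * w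
  before = solve-∀
  after : ∀ a n x → (a + suc n) * x ≡ suc a * x + n * x
  after = solve-∀

-- Pascal's rule on `n C j` splits the sum just as `T` recurses: shifting `j` replaces `a` by
-- `suc a`.
T-binomial : ∀ a n m → ∑< (suc n) (λ j → (n C j) * ((a + j) C m)) ≡ T a n m
T-binomial a zero    m = begin
  1 * ((a + 0) C m) + 0  ≡⟨ +-identityʳ _ ⟩
  1 * ((a + 0) C m)      ≡⟨ *-identityˡ _ ⟩
  (a + 0) C m            ≡⟨ cong (_C m) (+-identityʳ a) ⟩
  a C m                  ∎
  where open ≡-Reasoning
T-binomial a (suc n) m = begin
  ∑< (suc (suc n)) (λ j → (suc n C j) * f j)
    ≡⟨ ∑<-pascal n (suc n) f ⟩
  ∑< (suc n) (λ j → (n C j) * f (suc j)) + ∑< (suc (suc n)) (λ j → (n C j) * f j)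
    ≡⟨ cong₂ _+_ shifted truncated ⟩
  T (suc a) n m + T a n m
    ≡⟨ +-comm (T (suc a) n m) (T a n m) ⟩
  T a n m + T (suc a) n m ∎
  where
  open ≡-Reasoning
  f : ℕ → ℕ
  f j = (a + j) C m
  shifted : ∑< (suc n) (λ j → (n C j) * f (suc j)) ≡ T (suc a) n m
  shifted = trans (∑<-cong (suc n) λ j _ → cong (λ b → (n C j) * (b C m)) (+-suc a j))
                  (T-binomial (suc a) n m)
  truncated : ∑< (suc (suc n)) (λ j → (n C j) * f j) ≡ T a n m
  truncated = begin
    ∑< (suc (suc n)) (λ j → (n C j) * f j)
      ≡⟨ ∑<-last (suc n) (λ j → (n C j) * f j) ⟩
    ∑< (suc n) (λ j → (n C j) * f j) + (n C suc n) * f (suc n)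
      ≡⟨ cong₂ (λ s c → s + c * f (suc n)) (T-binomial a n m) (k>n⇒nCk≡0 (n<1+n n)) ⟩
    T a n m + 0
      ≡⟨ +-identityʳ (T a n m) ⟩
    T a n m ∎

-- The convolution of the coefficients of (1 + z)ᵃ and (2 + z)ⁿ, by induction on `a`. Since
-- `suc m ∸ suc i` computes to `m ∸ i`, the shifted sum is the instance at `m`, and `T-pascal`
-- recombines the two.
T-vandermonde : ∀ a n m → ∑< (suc m) (λ i → (a C i) * T 0 n (m ∸ i)) ≡ T a n m
T-vandermonde zero n m = begin
  ∑< (suc m) (λ i → (0 C i) * T 0 n (m ∸ i))  ≡⟨ ∑<-suc m (λ i → (0 C i) * T 0 n (m ∸ i)) ⟩
  1 * T 0 n m + ∑< m (λ i → 0)                ≡⟨ cong (1 * T 0 n m +_) (∑<-zero m) ⟩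
  1 * T 0 n m + 0                             ≡⟨ trans (+-identityʳ _) (*-identityˡ _) ⟩
  T 0 n m                                     ∎
  where
  open ≡-Reasoning
  ∑<-zero : ∀ l → ∑< l (λ i → 0) ≡ 0
  ∑<-zero zero    = refl
  ∑<-zero (suc l) = trans (∑<-suc l (λ i → 0)) (∑<-zero l)
T-vandermonde (suc a) n zero = begin
  1 * T 0 n 0 + 0  ≡⟨ trans (+-identityʳ _) (*-identityˡ _) ⟩
  T 0 n 0          ≡⟨ T-zero 0 n ⟩
  2 ^ n            ≡⟨ T-zero (suc a) n ⟨
  T (suc a) n 0    ∎
  where open ≡-Reasoning
T-vandermonde (suc a) n (suc m) = begin
  ∑< (suc (suc m)) (λ i → (suc a C i) * f i)
    ≡⟨ ∑<-pascal a (suc m) f ⟩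
  ∑< (suc m) (λ i → (a C i) * f (suc i)) + ∑< (suc (suc m)) (λ i → (a C i) * f i)
    ≡⟨ cong₂ _+_ (T-vandermonde a n m) (T-vandermonde a n (suc m)) ⟩
  T a n m + T a n (suc m)
    ≡⟨ T-pascal a n m ⟨
  T (suc a) n (suc m) ∎
  where
  open ≡-Reasoning
  f : ℕ → ℕ
  f i = T 0 n (suc m ∸ i)

T-power : ∀ n m → T 0 n m ≡ 2 ^ (n ∸ m) * (n C m)
T-power n       zero    = trans (T-zero 0 n) (sym (*-identityʳ _))
T-power zero    (suc m) = refl
T-power (suc n) (suc m) = begin
  T 0 n (suc m) + T 1 n (suc m)
    ≡⟨ cong (T 0 n (suc m) +_) (T-pascal 0 n m) ⟩
  T 0 n (suc m) + (T 0 n m + T 0 n (suc m))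
    ≡⟨ cong₂ (λ u v → u + (v + u)) (T-power n (suc m)) (T-power n m) ⟩
  p * y + (2 ^ (n ∸ m) * x + p * y)
    ≡⟨ before p (2 ^ (n ∸ m)) x y ⟩
  2 ^ (n ∸ m) * x + (2 * p) * y
    ≡⟨ cong (_+_ (2 ^ (n ∸ m) * x)) double ⟩
  2 ^ (n ∸ m) * x + 2 ^ (n ∸ m) * y
    ≡⟨ *-distribˡ-+ (2 ^ (n ∸ m)) x y ⟨
  2 ^ (n ∸ m) * (x + y)
    ≡⟨ cong (2 ^ (n ∸ m) *_) (pascal n m) ⟨
  2 ^ (n ∸ m) * (suc n C suc m) ∎
  where
  open ≡-Reasoning
  p = 2 ^ (n ∸ suc m)
  x = n C m
  y = n C suc m
  before : ∀ p q x y → p * y + (q * x + p * y) ≡ q * x + (2 * p) * y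
  before = solve-∀
  double : (2 * p) * y ≡ 2 ^ (n ∸ m) * y
  -- Truncated subtraction breaks 2 * 2 ^ (n ∸ (m + 1)) = 2 ^ (n ∸ m) when n ≤ m, but then `y` is
  -- zero.
  double with ≤-<-connex n m
  ... | inj₁ n≤m = trans (cong (2 * p *_) y≡0) (trans (*-zeroʳ (2 * p))
                     (sym (trans (cong (2 ^ (n ∸ m) *_) y≡0) (*-zeroʳ (2 ^ (n ∸ m))))))
    where
    y≡0 : y ≡ 0
    y≡0 = k>n⇒nCk≡0 (s≤s n≤m)
  ... | inj₂ m<n = cong (λ e → 2 ^ e * y) (sym (+-∸-assoc 1 m<n))

-- Closed form for the number of completions.

module Paths (k-1 : ℕ) where

  k : ℕ
  k = suc k-1

  -- This is G, with the summands in the order U, D, H. With no rows left only down steps remain,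
  -- hence the value 1; at height 0 the down step is forbidden.
  ways : ℕ → ℕ → ℕ
  ways h       zero    = 1
  ways zero    (suc n) = ways k n + ways k-1 n
  ways (suc h) (suc n) = ways (suc h + k) n + (ways h (suc n) + ways (suc h + k-1) n)

  -- G = T a (n + 1) (n + 1) + T a n n - k T a (n + 1) n
  Ballot : ℕ → ℕ → ℕ → Set
  Ballot a n G = G + k * T a (suc n) n ≡ T a (suc n) (suc n) + T a n n

  -- The hypothesis on `a` says that the height is -1. The resulting 0 stands for the forbidden down
  -- step, so that height 0 obeys the same recurrence as the others.
  ballot-boundary : ∀ a n → suc a ≡ k * suc n → Ballot a n 0
  ballot-boundary a n eq = *-cancelˡ-≡ _ _ (suc n) (begin
    suc n * (k * x)                             ≡⟨ arith (suc n) k x ⟩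
    (k * suc n) * x                             ≡⟨ cong (_* x) eq ⟨
    suc a * x                                   ≡⟨ T-diagonal a n ⟨
    suc n * (T a (suc n) (suc n) + T a n n)     ∎)
    where
    open ≡-Reasoning
    x = T a (suc n) n
    arith : ∀ n k x → n * (k * x) ≡ (k * n) * x
    arith = solve-∀

  -- The recurrence with one row left. The two 1s count the completions after U and H, which leave
  -- no row, whereas `Ballot` speaks of at least one.
  ballot-step-zero : ∀ a G → Ballot a 0 G → Ballot (suc a) 0 (1 + (G + 1))
  ballot-step-zero a G eq = begin
    1 + (G + 1) + k * 2                                             ≡⟨ before G k ⟩
    2 + (G + k * 2)                                                 ≡⟨ cong (2 +_) eq ⟩
    2 + (T a 1 1 + 1)                                               ≡⟨ +-assoc 2 (T a 1 1) 1 ⟨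
    2 + T a 1 1 + 1                                                 ≡⟨ cong (_+ 1) (T-pascal a 1 0) ⟨
    T (suc a) 1 1 + 1                                               ∎
    where
    open ≡-Reasoning
    before : ∀ G k → 1 + (G + 1) + k * 2 ≡ 2 + (G + k * 2)
    before = solve-∀

  -- As a is the height plus k times the number of rows left, U preserves it while D and H lower it
  -- by one. Hence `u` sits at `suc a`, and `G` and `v` at `a`.
  ballot-step-suc : ∀ a n G u v → Ballot a (suc n) G → Ballot (suc a) n u → Ballot a n v →
    Ballot (suc a) (suc n) (u + (G + v))
  ballot-step-suc a n G u v eqG equ eqv = begin
    u + (G + v) + k * T (suc a) (suc (suc n)) (suc n)
      -- The part `T a (suc (suc n)) n` of this split is `p + q` by definition: `p` serves the
      -- hypothesis on `v`, and `q` the one on `u`.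
      ≡⟨ cong (λ d → u + (G + v) + k * d) (T-pascal a (suc (suc n)) n) ⟩
    u + (G + v) + k * ((p + q) + T a (suc (suc n)) (suc n))
      ≡⟨ before u G v k p q _ ⟩
    (G + k * T a (suc (suc n)) (suc n)) + (u + k * q) + (v + k * p)
      ≡⟨ cong₂ _+_ (cong₂ _+_ eqG equ) eqv ⟩
    (x + T a (suc n) (suc n)) + (T (suc a) (suc n) (suc n) + T (suc a) n n) + (T a (suc n) (suc n) + T a n n)
      ≡⟨ after x (T a (suc n) (suc n)) (T (suc a) (suc n) (suc n)) (T (suc a) n n) (T a n n) ⟩
    ((T a (suc n) (suc n) + T (suc a) (suc n) (suc n)) + x) + ((T a n n + T (suc a) n n) + T a (suc n) (suc n))
      ≡⟨ cong₂ _+_ (T-pascal a (suc (suc n)) (suc n)) (T-pascal a (suc n) n) ⟨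
    T (suc a) (suc (suc n)) (suc (suc n)) + T (suc a) (suc n) (suc n) ∎
    where
    open ≡-Reasoning
    p = T a (suc n) n
    q = T (suc a) (suc n) n
    x = T a (suc (suc n)) (suc (suc n))
    before : ∀ u G v k p q r → u + (G + v) + k * ((p + q) + r) ≡ (G + k * r) + (u + k * q) + (v + k * p)
    before = solve-∀
    after : ∀ x y z t w → (x + y) + (z + t) + (y + w) ≡ ((y + z) + x) + ((w + t) + y)
    after = solve-∀

  ways-ballot : ∀ n h → Ballot (h + k * suc n) n (ways h (suc n))
  -- The 0 is the missing down step. Its height -1 gives `k-1 * 1`, whose successor computes to
  -- `k * 1`.
  ways-ballot zero    zero    = ballot-step-zero (k-1 * 1) 0 (ballot-boundary (k-1 * 1) 0 refl)
  ways-ballot zero    (suc h) = ballot-step-zero (h + k * 1) (ways h 1) (ways-ballot zero h)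
  ways-ballot (suc n) zero    =
    ballot-step-suc _ n 0 (ways k (suc n)) (ways k-1 (suc n)) (ballot-boundary _ (suc n) refl)
      (subst (λ a → Ballot a n (ways k (suc n))) (up k n) (ways-ballot n k))
      (subst (λ a → Ballot a n (ways k-1 (suc n))) (cong pred (up k n)) (ways-ballot n k-1))
    where
    up : ∀ k n → k + k * suc n ≡ k * suc (suc n)
    up = solve-∀
  ways-ballot (suc n) (suc h) =
    ballot-step-suc _ n (ways h (suc (suc n))) (ways (suc h + k) (suc n)) (ways (suc h + k-1) (suc n))
      (ways-ballot (suc n) h)
      (subst (λ a → Ballot a n (ways (suc h + k) (suc n))) (up (suc h) k n) (ways-ballot n (suc h + k)))
      (subst (λ a → Ballot a n (ways (suc h + k-1) (suc n))) (horizontal h k-1 n) (ways-ballot n (suc h + k-1)))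
    where
    up : ∀ h k n → (h + k) + k * suc n ≡ h + k * suc (suc n)
    up = solve-∀
    horizontal : ∀ h k-1 n → (suc h + k-1) + suc k-1 * suc n ≡ h + suc k-1 * suc (suc n)
    horizontal = solve-∀

  -- At height 0 the right side of `T-diagonal` is `x + k * suc n * x`, whose second term cancels
  -- the correction in `Ballot`. Division by `suc n` is left to the rationals.
  ways-zero : ∀ n → suc n * ways 0 (suc n) ≡ T (k * suc n) (suc n) n
  ways-zero n = +-cancelʳ-≡ (k * suc n * x) _ _ (begin
    suc n * G + k * suc n * x                  ≡⟨ before (suc n) G k x ⟩
    suc n * (G + k * x)                        ≡⟨ cong (suc n *_) (ways-ballot n 0) ⟩
    suc n * (T a (suc n) (suc n) + T a n n)    ≡⟨ T-diagonal a n ⟩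
    x + k * suc n * x                          ∎)
    where
    open ≡-Reasoning
    a = k * suc n
    G = ways 0 (suc n)
    x = T a (suc n) n
    before : ∀ n G k x → n * G + k * n * x ≡ n * (G + k * x)
    before = solve-∀

  -- Bijection of paths with finite sets.

  module _ (n : ℕ) where

    end : Point
    end = k * n , n

    -- The start varies because removing the first step moves it; at (0 , 0) this is `SchB n k` by
    -- computation.
    PathFrom : Point → Set
    PathFrom p = Σ (List Step) λ w → foldl move p w ≡ end × All (OnOrAboveLine k) (scanl move p w)

    point-irrelevant : ∀ {p q : Point} (e e′ : p ≡ q) → e ≡ e′
    point-irrelevant = Decidable⇒UIP.≡-irrelevant (≡-dec _≟_ _≟_)

    firstStep : ∀ p → OnOrAboveLine k p →
      PathFrom p ↔ (p ≡ end ⊎ PathFrom (move p U) ⊎ PathFrom (move p D) ⊎ PathFrom (move p H))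
    firstStep p ok = mk↔ₛ′ to from to∘from from∘to
      where
      to : PathFrom p → _
      to ([]    , e , _)      = inj₁ e
      to (U ∷ w , e , _ ∷ as) = inj₂ (inj₁ (w , e , as))
      to (D ∷ w , e , _ ∷ as) = inj₂ (inj₂ (inj₁ (w , e , as)))
      to (H ∷ w , e , _ ∷ as) = inj₂ (inj₂ (inj₂ (w , e , as)))
      from : _ → PathFrom p
      from (inj₁ e)                             = [] , e , ok ∷ []
      from (inj₂ (inj₁ (w , e , as)))           = U ∷ w , e , ok ∷ as
      from (inj₂ (inj₂ (inj₁ (w , e , as))))    = D ∷ w , e , ok ∷ as
      from (inj₂ (inj₂ (inj₂ (w , e , as))))    = H ∷ w , e , ok ∷ as
      to∘from : ∀ c → to (from c) ≡ c
      to∘from (inj₁ e)               = refl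
      to∘from (inj₂ (inj₁ _))        = refl
      to∘from (inj₂ (inj₂ (inj₁ _))) = refl
      to∘from (inj₂ (inj₂ (inj₂ _))) = refl
      from∘to : ∀ c → from (to c) ≡ c
      -- `from` puts `ok` in place of the path's own proof at `p`; proofs of `≤` are unique.
      from∘to ([]    , e , a ∷ []) = cong (λ a → [] , e , a ∷ []) (≤-irrelevant ok a)
      from∘to (U ∷ w , e , a ∷ as) = cong (λ a → U ∷ w , e , a ∷ as) (≤-irrelevant ok a)
      from∘to (D ∷ w , e , a ∷ as) = cong (λ a → D ∷ w , e , a ∷ as) (≤-irrelevant ok a)
      from∘to (H ∷ w , e , a ∷ as) = cong (λ a → H ∷ w , e , a ∷ as) (≤-irrelevant ok a)

    empty↔Fin0 : ∀ {A : Set} → ¬ A → A ↔ Fin 0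
    empty↔Fin0 ¬a = ↔-trans (mk↔ₛ′ ¬a ⊥-elim (λ ()) (λ a → ⊥-elim (¬a a))) (↔-sym 0↔⊥)

    at-end : ∀ {p} → p ≡ end → (p ≡ end) ↔ Fin 1
    at-end e = ↔-trans (mk↔ₛ′ (λ _ → tt) (λ _ → e) (λ _ → refl) (point-irrelevant e)) (↔-sym 1↔⊤)

    below-empty : ∀ {p} → ¬ OnOrAboveLine k p → ¬ PathFrom p
    below-empty ¬ok (w , _ , as) = ¬ok (head as)

    foldl-move-≤ : ∀ p w → proj₂ p ≤ proj₂ (foldl move p w)
    foldl-move-≤ p []      = ≤-refl
    foldl-move-≤ p (U ∷ w) = <⇒≤ (foldl-move-≤ (move p U) w)
    foldl-move-≤ p (D ∷ w) = foldl-move-≤ (move p D) w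
    foldl-move-≤ p (H ∷ w) = <⇒≤ (foldl-move-≤ (move p H) w)

    above-empty : ∀ {p} → n < proj₂ p → ¬ PathFrom p
    above-empty n<y (w , e , _) = <⇒≱ n<y (subst (_ ≤_) (cong proj₂ e) (foldl-move-≤ _ w))

    -- The summands are ordered so that, with 0 for each impossible option, the size computes to the
    -- matching clause of `ways`.
    count : ∀ {p c u d h} → OnOrAboveLine k p → (p ≡ end) ↔ Fin c →
      PathFrom (move p U) ↔ Fin u → PathFrom (move p D) ↔ Fin d → PathFrom (move p H) ↔ Fin h →
      PathFrom p ↔ Fin (c + (u + (d + h)))
    count {p} ok c u d h = ↔-trans (firstStep p ok) (c ⊹ (u ⊹ (d ⊹ h)))
      where
      _⊹_ : ∀ {A B : Set} {m n} → A ↔ Fin m → B ↔ Fin n → (A ⊎ B) ↔ Fin (m + n)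
      f ⊹ g = ↔-trans (f ⊎-↔ g) (↔-sym +↔⊎)

    height-≤ : ∀ {x h y} → x + h ≡ k * y → x ≤ k * y
    height-≤ e = m+n≤o⇒m≤o _ (≤-reflexive e)

    no-descent : ∀ {x y} → x + 0 ≡ k * y → ¬ PathFrom (suc x , y)
    no-descent e = below-empty (<⇒≱ (s≤s (≤-reflexive (trans (sym e) (+-identityʳ _)))))

    descend : ∀ {x y} h → x + suc h ≡ k * y → suc x + h ≡ k * y
    descend h e = trans (sym (+-suc _ h)) e

    raise : ∀ {x y} h → x + h ≡ k * y → x + (h + k) ≡ k * suc y
    raise {x} {y} h e = begin
      x + (h + k)  ≡⟨ +-assoc x h k ⟨
      x + h + k    ≡⟨ cong (_+ k) e ⟩
      k * y + k    ≡⟨ +-comm (k * y) k ⟩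
      k + k * y    ≡⟨ *-suc k y ⟨
      k * suc y    ∎
      where open ≡-Reasoning

    raise-shift : ∀ {x y} h → x + h ≡ k * y → suc x + (h + k-1) ≡ k * suc y
    raise-shift {x} h e = trans (arith x h k-1) (raise h e)
      where
      arith : ∀ x h k-1 → suc x + (h + k-1) ≡ x + (h + suc k-1)
      arith = solve-∀

    -- The height `h` enters by an equation free of subtraction. The recursion is that of `ways`: U
    -- and H lower `r`, while D keeps `r` and lowers `h`.
    paths↔Fin : ∀ r h x y → x + h ≡ k * y → y + r ≡ n → PathFrom (x , y) ↔ Fin (ways h r)
    paths↔Fin zero zero x y height rows =
      count (height-≤ height) (at-end (cong₂ _,_ (trans (sym (+-identityʳ x)) (trans height (cong (k *_) y≡n))) y≡n))
        (empty↔Fin0 (above-empty n<1+y)) (empty↔Fin0 (no-descent height)) (empty↔Fin0 (above-empty n<1+y))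
      where
      y≡n : y ≡ n
      y≡n = trans (sym (+-identityʳ y)) rows
      n<1+y : n < suc y
      n<1+y = s≤s (≤-reflexive (sym y≡n))
    paths↔Fin zero (suc h) x y height rows =
      -- On the last row but short of the endpoint, only D can follow.
      count (height-≤ height) (empty↔Fin0 x≢kn)
        (empty↔Fin0 (above-empty n<1+y)) (paths↔Fin zero h (suc x) y (descend h height) rows) (empty↔Fin0 (above-empty n<1+y))
      where
      y≡n : y ≡ n
      y≡n = trans (sym (+-identityʳ y)) rows
      n<1+y : n < suc y
      n<1+y = s≤s (≤-reflexive (sym y≡n))
      x≢kn : ¬ (x , y) ≡ end
      x≢kn e = m+1+n≢m x (trans height (trans (cong (k *_) y≡n) (sym (cong proj₁ e))))
    paths↔Fin (suc r) zero x y height rows =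
      count (height-≤ height) (empty↔Fin0 λ e → m+1+n≢m y (trans rows (sym (cong proj₂ e))))
        (paths↔Fin r k x (suc y) (raise 0 height) (trans (sym (+-suc y r)) rows))
        (empty↔Fin0 (no-descent height))
        (paths↔Fin r k-1 (suc x) (suc y) (raise-shift 0 height) (trans (sym (+-suc y r)) rows))
    paths↔Fin (suc r) (suc h) x y height rows =
      count (height-≤ height) (empty↔Fin0 λ e → m+1+n≢m y (trans rows (sym (cong proj₂ e))))
        (paths↔Fin r (suc h + k) x (suc y) (raise (suc h) height) (trans (sym (+-suc y r)) rows))
        (paths↔Fin (suc r) h (suc x) y (descend h height) rows)
        (paths↔Fin r (suc h + k-1) (suc x) (suc y) (raise-shift (suc h) height) (trans (sym (+-suc y r)) rows))

    SchB↔Fin : SchB n k ↔ Fin (ways 0 n)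
    SchB↔Fin = paths↔Fin n 0 0 0 (sym (*-zeroʳ k)) refl

-- The two formulas over the rationals.

-- Opened only here: with +_ in scope, sections such as (f 0 +_) become ambiguous.
open import Data.Integer using (+_)

-- In the unnormalised rationals the equation becomes a cross multiplication, free of the gcds
-- hidden in `_/_`.
fromℕ-average : ∀ n N S → suc n * N ≡ S → fromℕ N ≡ (+ 1 / suc n) *ℚ fromℕ S
fromℕ-average n N S eq = toℚᵘ-injective (begin
  toℚᵘ (fromℕ N)                             ≈⟨ toℚᵘ-fromℚᵘ (mkℚᵘ (+ N) 0) ⟩
  mkℚᵘ (+ N) 0                               ≈⟨ *≡* cross ⟩
  mkℚᵘ (+ 1) n ℚᵘ.* mkℚᵘ (+ S) 0             ≈⟨ ℚᵘ.*-cong (toℚᵘ-fromℚᵘ (mkℚᵘ (+ 1) n)) (toℚᵘ-fromℚᵘ (mkℚᵘ (+ S) 0)) ⟨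
  toℚᵘ (+ 1 / suc n) ℚᵘ.* toℚᵘ (fromℕ S)     ≈⟨ toℚᵘ-homo-* (+ 1 / suc n) (fromℕ S) ⟨
  toℚᵘ ((+ 1 / suc n) *ℚ fromℕ S)            ∎)
  where
  open import Relation.Binary.Reasoning.Setoid ℚᵘ.≃-setoid
  cross : + N ℤ.* + (suc n * 1) ≡ (+ 1 ℤ.* + S) ℤ.* + 1
  cross = trans (sym (ℤ.pos-* N (suc n * 1))) (trans (cong +_ (trans (arith (suc n) N) eq))
    (sym (trans (ℤ.*-identityʳ _) (ℤ.*-identityˡ (+ S)))))
    where
    arith : ∀ n N → N * (n * 1) ≡ n * N
    arith = solve-∀

-- `T-vandermonde` with its factors rewritten by `T-power` at n - m, which gives the exponent (n +
-- 1) - (n - m) = m + 1. Throughout m ≤ n, so the truncated subtractions are exact.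
∑-powers : ∀ k n →
  ∑< (suc n) (λ m → 2 ^ (m + 1) * ((suc n * k) C m) * (suc n C (suc n ∸ m ∸ 1))) ≡ T (k * suc n) (suc n) n
∑-powers k n = trans (∑<-cong (suc n) λ m m<1+n → term m (≤-pred m<1+n)) (T-vandermonde (k * suc n) (suc n) n)
  where
  open ≡-Reasoning
  arith : ∀ p c d → p * c * d ≡ c * (p * d)
  arith = solve-∀
  term : ∀ m → m ≤ n → 2 ^ (m + 1) * ((suc n * k) C m) * (suc n C (suc n ∸ m ∸ 1))
    ≡ ((k * suc n) C m) * T 0 (suc n) (n ∸ m)
  term m m≤n = begin
    2 ^ (m + 1) * ((suc n * k) C m) * (suc n C (suc n ∸ m ∸ 1))
      ≡⟨ arith (2 ^ (m + 1)) _ _ ⟩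
    ((suc n * k) C m) * (2 ^ (m + 1) * (suc n C (suc n ∸ m ∸ 1)))
      ≡⟨ cong₂ (λ a t → (a C m) * t) (*-comm (suc n) k)
           (cong₂ (λ e b → 2 ^ e * (suc n C b)) exponent (cong (_∸ 1) (+-∸-assoc 1 m≤n))) ⟩
    ((k * suc n) C m) * (2 ^ (suc n ∸ (n ∸ m)) * (suc n C (n ∸ m)))
      ≡⟨ cong (((k * suc n) C m) *_) (T-power (suc n) (n ∸ m)) ⟨
    ((k * suc n) C m) * T 0 (suc n) (n ∸ m) ∎
    where
    exponent : m + 1 ≡ suc n ∸ (n ∸ m)
    exponent = begin
      m + 1                ≡⟨ +-comm m 1 ⟩
      suc m                ≡⟨ cong suc (m∸[m∸n]≡n m≤n) ⟨
      1 + (n ∸ (n ∸ m))    ≡⟨ +-∸-assoc 1 (m∸n≤m n m) ⟨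
      suc n ∸ (n ∸ m)      ∎

proposition4p11 : (k n : ℕ) .{{_ : NonZero k}} .{{_ : NonZero n}} →
    ∃ λ (N : ℕ) → (SchB n k ↔ Fin N)
    × (fromℕ N ≡ (+ 1 / n) *ℚ fromℕ (∑< n (λ m → 2 ^ (m + 1) * ((n * k) C m) * (n C (n ∸ m ∸ 1)))))
    × (fromℕ N ≡ (+ 1 / n) *ℚ fromℕ (∑< (suc n) (λ j → (n C j) * ((k * n + j) C (n ∸ 1)))))
proposition4p11 (suc k-1) (suc n) = ways 0 (suc n) , SchB↔Fin (suc n)
  , fromℕ-average n _ _ (trans (ways-zero n) (sym (∑-powers k n)))
  , fromℕ-average n _ _ (trans (ways-zero n) (sym (T-binomial (k * suc n) (suc n) n)))
  where open Paths k-1
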